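{- Let $G$ be a finite abelian group of type $(n_1,\dots,n_r)$ and order $n=n_1\cdots n_r$, let $m$ be a positive integer with $m\leq n$, and let $h\geq 2$ be an integer. Then $$\rho_{\pm}(G,m,h)\leq \min\{f_d(m,h) \; : \; d\in D(G,m)\},$$ where $$D(G,m)=\{d\in D(n) \; : \; d=d_1\cdots d_r \text{ for some } d_1\in D(n_1),\dots,d_r\in D(n_r) \text{ with } dn_r\geq d_rm\}.$$
   Context: A finite abelian group $G$ (written additively) has type $(n_1,\dots,n_r)$, $r\ge1$, if $G\cong\mathbb{Z}_{n_1}\times\cdots\times\mathbb{Z}_{n_r}$, where $n_1\geq 2$ and $n_i$ divides $n_{i+1}$ for each $i\in\{1,\dots,r-1\}$. For an $m$-subset $A=\{a_1,\dots,a_m\}$ of $G$ (with $m\ge 1$), the $h$-fold signed sumset is $$h_{\pm}A=\Big\{ \sum_{i=1}^m \lambda_i a_i : (\lambda_1,\dots,\lambda_m)\in\mathbb{Z}^m,\ \sum_{i=1}^m|\lambda_i|=h\Big\},$$ and $\rho_{\pm}(G,m,h)=\min\{|h_{\pm}A| : A\subseteq G,\ |A|=m\}$. For a positive integer $k$, $D(k)$ is the set of positive divisors of $k$. For positive integers $d,m,h$, $$f_d(m,h)=\left(h\lceil m/d\rceil-h+1\right)\cdot d.$$ -}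

module Defs where

open import Algebra.Bundles using (AbelianGroup)
import Algebra.Definitions.RawMonoid as RawMonoid
open import Algebra.Morphism.Structures using (module GroupMorphisms)
open import Data.Fin.Base using (Fin; zero; suc; inject₁)
open import Data.Integer.Base using (ℤ; +_; -[1+_]; ∣_∣; 0ℤ)
import Data.Integer.Base as ℤ
import Data.Integer.Divisibility.Signed as ℤ∣
import Data.Integer.Properties as ℤₚ
open import Data.Integer.Tactic.RingSolver using (solve-∀)
open import Data.Nat.Base using (ℕ; suc; _+_; _*_; _∸_; _≤_; NonZero; _/_)
open import Data.Nat.Divisibility.Core using (_∣_)
open import Data.Product.Base using (Σ; ∃; ∃-syntax; _×_; _,_; proj₁)
open import Data.Vec.Functional using (Vector; foldr; last)
open import Function.Base using (_∘_)
open import Function.Bundles using (Bijection)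
open import Function.Definitions using (Injective)
open import Level using (0ℓ; _⊔_)
open import Relation.Binary.Bundles using (Setoid)
import Relation.Binary.Construct.On as On
open import Relation.Binary.PropositionalEquality
  using (_≡_; refl; subst)
import Relation.Binary.PropositionalEquality.Properties as ≡
open import Relation.Unary using (Pred; _∈_)

∑ : ∀ {r} → Vector ℕ r → ℕ
∑ = foldr _+_ 0

∏ : ∀ {r} → Vector ℕ r → ℕ
∏ = foldr _*_ 1

infix 4 _IsMinimumOf_

_IsMinimumOf_ : ∀ {p} → ℕ → Pred ℕ p → Set p
k IsMinimumOf P = (k ∈ P) × (∀ {j} → j ∈ P → k ≤ j)

-- The cardinality of a subset of a setoid, counted up to the setoid equality.

HasCardinality : ∀ {c ℓ p} (S : Setoid c ℓ) →
                 Pred (Setoid.Carrier S) p → ℕ → Set (c ⊔ ℓ ⊔ p)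
HasCardinality S P k =
  Bijection (≡.setoid (Fin k)) (On.setoid {B = ∃ P} S proj₁)

infix 4 _≡_[mod_]

record _≡_[mod_] (x y : ℤ) (n : ℕ) : Set where
  constructor congruent
  field difference : (+ n) ℤ∣.∣ (x ℤ.- y)

-- ℤ/nℤ as the integers under congruence modulo n (so that n = 0 gives ℤ).

ℤmod : ℕ → AbelianGroup 0ℓ 0ℓ
ℤmod n = record
  { Carrier = ℤ
  ; _≈_     = _≡_[mod n ]
  ; _∙_     = ℤ._+_
  ; ε       = 0ℤ
  ; _⁻¹     = ℤ.-_
  ; isAbelianGroup = record
    { isGroup = record
      { isMonoid = record
        { isSemigroup = record
          { isMagma = record
            { isEquivalence = record
              { refl  = ≈-refl
              ; sym   = ≈-sym
              ; trans = ≈-trans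
              }
            ; ∙-cong = +-cong
            }
          ; assoc = λ x y z → ≈-reflexive (ℤₚ.+-assoc x y z)
          }
        ; identity = (λ x → ≈-reflexive (ℤₚ.+-identityˡ x))
                   , (λ x → ≈-reflexive (ℤₚ.+-identityʳ x))
        }
      ; inverse = (λ x → ≈-reflexive (ℤₚ.+-inverseˡ x))
                , (λ x → ≈-reflexive (ℤₚ.+-inverseʳ x))
      ; ⁻¹-cong = neg-cong
      }
    ; comm = λ x y → ≈-reflexive (ℤₚ.+-comm x y)
    }
  }
  where
  infix 4 _≈_
  _≈_ : ℤ → ℤ → Set
  x ≈ y = x ≡ y [mod n ]

  ≈-refl : ∀ {x} → x ≈ x
  ≈-refl {x} = congruent (ℤ∣.divides 0ℤ (ℤₚ.+-inverseʳ x))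

  ≈-reflexive : ∀ {x y} → x ≡ y → x ≈ y
  ≈-reflexive refl = ≈-refl

  ≈-sym : ∀ {x y} → x ≈ y → y ≈ x
  ≈-sym {x} {y} (congruent p) =
    congruent (subst ((+ n) ℤ∣.∣_) (eq x y) (ℤ∣.∣m⇒∣-m p))
    where
    eq : ∀ x y → ℤ.- (x ℤ.- y) ≡ y ℤ.- x
    eq = solve-∀

  ≈-trans : ∀ {x y z} → x ≈ y → y ≈ z → x ≈ z
  ≈-trans {x} {y} {z} (congruent p) (congruent q) =
    congruent (subst ((+ n) ℤ∣.∣_) (eq x y z) (ℤ∣.∣m∣n⇒∣m+n p q))
    where
    eq : ∀ x y z → (x ℤ.- y) ℤ.+ (y ℤ.- z) ≡ x ℤ.- z
    eq = solve-∀

  +-cong : ∀ {x y u v} → x ≈ y → u ≈ v → x ℤ.+ u ≈ y ℤ.+ v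
  +-cong {x} {y} {u} {v} (congruent p) (congruent q) =
    congruent (subst ((+ n) ℤ∣.∣_) (eq x y u v) (ℤ∣.∣m∣n⇒∣m+n p q))
    where
    eq : ∀ x y u v → (x ℤ.- y) ℤ.+ (u ℤ.- v) ≡ (x ℤ.+ u) ℤ.- (y ℤ.+ v)
    eq = solve-∀

  neg-cong : ∀ {x y} → x ≈ y → ℤ.- x ≈ ℤ.- y
  neg-cong {x} {y} (congruent p) =
    congruent (subst ((+ n) ℤ∣.∣_) (eq x y) (ℤ∣.∣m⇒∣-m p))
    where
    eq : ∀ x y → ℤ.- (x ℤ.- y) ≡ (ℤ.- x) ℤ.- (ℤ.- y)
    eq = solve-∀

∏ᴳ : ∀ {i c ℓ} {I : Set i} →
     (I → AbelianGroup c ℓ) → AbelianGroup (i ⊔ c) (i ⊔ ℓ)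
∏ᴳ Gs = record
  { Carrier = ∀ i → G.Carrier i
  ; _≈_     = λ x y → ∀ i → G._≈_ i (x i) (y i)
  ; _∙_     = λ x y i → G._∙_ i (x i) (y i)
  ; ε       = λ i → G.ε i
  ; _⁻¹     = λ x i → G._⁻¹ i (x i)
  ; isAbelianGroup = record
    { isGroup = record
      { isMonoid = record
        { isSemigroup = record
          { isMagma = record
            { isEquivalence = record
              { refl  = λ i → G.refl i
              ; sym   = λ p i → G.sym i (p i)
              ; trans = λ p q i → G.trans i (p i) (q i)
              }
            ; ∙-cong = λ p q i → G.∙-cong i (p i) (q i)
            }
          ; assoc = λ x y z i → G.assoc i (x i) (y i) (z i)
          }
        ; identity = (λ x i → G.identityˡ i (x i))
                   , (λ x i → G.identityʳ i (x i))
        }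
      ; inverse = (λ x i → G.inverseˡ i (x i))
                , (λ x i → G.inverseʳ i (x i))
      ; ⁻¹-cong = λ p i → G.⁻¹-cong i (p i)
      }
    ; comm = λ x y i → G.comm i (x i) (y i)
    }
  }
  where module G i = AbelianGroup (Gs i)

infix 4 _≅_

_≅_ : ∀ {c₁ ℓ₁ c₂ ℓ₂} →
      AbelianGroup c₁ ℓ₁ → AbelianGroup c₂ ℓ₂ → Set (c₁ ⊔ ℓ₁ ⊔ c₂ ⊔ ℓ₂)
G ≅ H = ∃ IsGroupIsomorphism
  where open GroupMorphisms (AbelianGroup.rawGroup G) (AbelianGroup.rawGroup H)

-- G has type (n₁, …, nᵣ), with r = suc s ≥ 1.

record HasType {c ℓ} (G : AbelianGroup c ℓ) {s} (ns : Vector ℕ (suc s)) :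
               Set (c ⊔ ℓ) where
  field
    n₁≥2        : 2 ≤ ns zero
    chain       : ∀ (i : Fin s) → ns (inject₁ i) ∣ ns (suc i)
    -- Not implied by chain, since every natural number divides 0.
    nonZero     : ∀ i → NonZero (ns i)
    isomorphism : G ≅ ∏ᴳ (ℤmod ∘ ns)

module _ {c ℓ} (G : AbelianGroup c ℓ) where

  open AbelianGroup G
  open RawMonoid rawMonoid using (sum) renaming (_×_ to _ℕ·_)

  infixr 8 _·_

  _·_ : ℤ → Carrier → Carrier
  (+ n)    · x = n ℕ· x
  -[1+ n ] · x = (suc n ℕ· x) ⁻¹

  -- The h-fold signed sumset of {a₁, …, aₘ}.

  SignedSumset : ∀ {m} → ℕ → Vector Carrier m → Pred Carrier ℓ
  SignedSumset {m} h a x =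
    Σ (Vector ℤ m) λ λs → ∑ (∣_∣ ∘ λs) ≡ h × sum (λ i → λs i · a i) ≈ x

  -- The numbers |h±A|, where A ranges over the m-subsets of G, each presented
  -- by an injective enumeration.

  SignedSumsetSize : ℕ → ℕ → Pred ℕ (c ⊔ ℓ)
  SignedSumsetSize m h k =
    Σ (Vector Carrier m) λ a →
      Injective _≡_ _≈_ a × HasCardinality setoid (SignedSumset h a) k

  Isρ± : ℕ → ℕ → ℕ → Set (c ⊔ ℓ)
  Isρ± m h ρ = ρ IsMinimumOf SignedSumsetSize m h

⌈_/_⌉ : ∀ (m d : ℕ) .{{_ : NonZero d}} → ℕ
⌈ m / d ⌉ = (m + (d ∸ 1)) / d

-- The truncated subtraction is exact for m ≥ 1, as then ⌈ m / d ⌉ ≥ 1.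

f : (d : ℕ) .{{_ : NonZero d}} → ℕ → ℕ → ℕ
f d m h = (h * ⌈ m / d ⌉ ∸ h + 1) * d

D : ℕ → Pred ℕ 0ℓ
D k d = NonZero d × d ∣ k

-- D(G,m) for G of type ns; it depends on G only through its type.

record DG {s} (ns : Vector ℕ (suc s)) (m d : ℕ) : Set where
  field
    d∈D[n]    : d ∈ D (∏ ns)
    ds        : Vector ℕ (suc s)
    dᵢ∈D[nᵢ]  : ∀ i → ds i ∈ D (ns i)
    d≡∏ds     : d ≡ ∏ ds
    bound     : last ds * m ≤ d * last ns

  d-nonZero : NonZero d
  d-nonZero = proj₁ d∈D[n]

fValue : ∀ {s} → Vector ℕ (suc s) → ℕ → ℕ → Pred ℕ 0ℓ
fValue ns m h v =
  ∃[ d ] Σ (d ∈ DG ns m) λ d∈DG → v ≡ f d {{DG.d-nonZero d∈DG}} m h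

{-# OPTIONS --safe #-}

-- Suppose d = d₁⋯dᵣ with nᵢ = qᵢdᵢ, and let k = ⌈m/d⌉; the bound on d gives
-- k ≤ qᵣ.  Take c with 2c + (k − 1) ≡ 0 (mod qᵣ) and let S be the set of those
-- x ∈ ∏ ℤ/nᵢ with qᵢ ∣ xᵢ for i < r and xᵣ ≡ c + j (mod qᵣ) for some 0 ≤ j < k.
-- Then S = −S, ∣S∣ = kd ≥ m, and h±A ⊆ hS for every A ⊆ S, where hS consists of
-- hk − h + 1 cosets of a subgroup of order d.  Such a c exists unless k and qᵣ
-- are both even; in that case 2dᵣ and k/2 can replace dᵣ and k, and the bound
-- (hk − h + 1)d does not increase.

module Submission where

open import Defs
open import Algebra.Bundles using (AbelianGroup)
import Algebra.Definitions.RawMonoid as RawMonoid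
open import Algebra.Morphism.Structures using (module GroupMorphisms)
import Algebra.Properties.Monoid.Mult as Mult
import Algebra.Properties.Monoid.Sum as Sum
open import Data.Fin.Base
  using (Fin; zero; suc; toℕ; fromℕ; fromℕ<; inject≤; combine; remQuot;
         splitAt; join; finToFun; funToFin)
import Data.Fin.Properties as Fin
open import Data.Integer.Base using (ℤ; +_; -[1+_]; -_; ∣_∣; 0ℤ)
import Data.Integer.Base as ℤ
import Data.Integer.DivMod as ℤ
import Data.Integer.Divisibility.Signed as ℤ∣
import Data.Integer.Properties as ℤ
import Data.Integer.Tactic.RingSolver as ℤ
open import Data.List.Base
  using (List; _∷_; length; lookup; tabulate; filter; deduplicate)
open import Data.List.Membership.Setoid.Properties
  using (∈-lookup; ∈-filter⁺; ∈-filter⁻; ∈-deduplicate⁺; ∈-deduplicate⁻;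
         ∈-tabulate⁺)
open import Data.List.Relation.Unary.All as All using (All)
open import Data.List.Relation.Unary.AllPairs using (_∷_)
import Data.List.Relation.Unary.Any as Any
open import Data.List.Relation.Unary.Any.Properties using (lookup-index)
open import Data.List.Relation.Unary.Unique.DecSetoid.Properties
  using (deduplicate-!)
open import Data.List.Relation.Unary.Unique.Setoid using (Unique)
open import Data.Nat.Base
  using (ℕ; zero; suc; _+_; _*_; _∸_; _/_; _%_; _⊔_; _≤_; _<_; z≤n; s≤s;
         NonZero; >-nonZero⁻¹)
open import Data.Nat.Divisibility using (_∣_; divides; quotient; ∣-refl; ∣⇒≤; >⇒∤; _∣?_)
open import Data.Nat.DivMod using (m≡m%n+[m/n]*n; m%n<n; m<n*o⇒m/o<n)
open import Data.Nat.Induction using (<-rec)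
open import Data.Nat.Properties renaming (_≟_ to _≟ℕ_)
import Data.Nat.Tactic.RingSolver as ℕ
open import Data.Product.Base
  using (∃; ∃₂; ∃-syntax; Σ-syntax; _×_; _,_; proj₁; proj₂; map₂; uncurry)
open import Data.Sum.Base using (_⊎_; inj₁; inj₂; [_,_]′)
open import Data.Vec.Functional using (Vector; last; tail; updateAt)
open import Data.Vec.Functional.Properties
  using (updateAt-updates; updateAt-minimal)
open import Function.Base using (_∘_; id)
open import Function.Bundles using (Bijection)
open import Function.Definitions using (Injective)
open import Level using (Level)
open import Relation.Binary.Bundles using (Setoid; DecSetoid)
open import Relation.Binary.Core using (Rel)
open import Relation.Binary.Definitions
  using (_Respects_) renaming (Decidable to Decidable₂)
open import Relation.Binary.PropositionalEquality
  using (_≡_; _≢_; refl; sym; trans; cong; cong₂; subst; subst₂; module ≡-Reasoning)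
open import Relation.Nullary using (Dec; yes; no; ¬_; contradiction)
open import Relation.Nullary.Decidable using (map′; _×-dec_; _→-dec_)
open import Relation.Unary using (Pred; Decidable; _∈_; _⊆_; _≐_)

private variable
  a b c ℓ p : Level
  A : Set a
  k l m n N r : ℕ

-- Finite search

-- Trying 0, 1, ... up to and including the given member must succeed: otherwise that member would
-- exceed itself. Constructively, this is how both minima of the theorem come to exist.
least : {P : Pred ℕ p} → Decidable P → k ∈ P → ∃[ μ ] μ IsMinimumOf P
least {P = P} P? pk = [ id , (λ lb → contradiction (lb pk) (<-irrefl refl)) ]′ (search _)
  where
  search : ∀ k → (∃[ μ ] μ IsMinimumOf P) ⊎ (∀ {j} → j ∈ P → k ≤ j)
  search zero    = inj₂ λ _ → z≤n
  search (suc k) with search k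
  ... | inj₁ min = inj₁ min
  ... | inj₂ lb with P? k
  ...   | yes pk = inj₁ (k , pk , lb)
  ...   | no ¬pk = inj₂ λ pj → ≤∧≢⇒< (lb pj) λ { refl → ¬pk pj }

-- There may be infinitely many vectors, but up to `_≈_` every solution has its entries among the N
-- values of `e`, so testing the finitely many vectors over those values decides existence. It
-- serves for coefficient vectors, for m-subsets and for tuples of divisors.
anyVector? : (_≈_ : Rel A ℓ) (e : Fin N → A) {P : Pred (Vector A m) p} →
             (∀ {xs ys} → (∀ i → xs i ≈ ys i) → P xs → P ys) →
             (∀ {xs} → P xs → ∀ i → ∃[ j ] xs i ≈ e j) →
             Decidable P → Dec (∃ P)
anyVector? _≈_ e resp bounded P? = map′
  (λ (c , pc) → e ∘ finToFun c , pc)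
  (λ (xs , pxs) → let g = proj₁ ∘ bounded pxs in
    funToFin g , resp (λ i → subst (λ j → xs i ≈ e j)
                              (sym (Fin.finToFun-funToFin g i))
                              (proj₂ (bounded pxs i))) pxs)
  (Fin.any? λ c → P? (e ∘ finToFun c))

-- Cardinalities

module _ (S : Setoid c ℓ) where

  open Setoid S using (Carrier; _≈_; reflexive)
    renaming (sym to ≈-sym; trans to ≈-trans)

  -- `e` may repeat values and may leave `P`, which is harmless for upper bounds on the cardinality
  -- and for finite search.
  Covers : (Fin N → Carrier) → Pred Carrier p → Set _
  Covers e P = ∀ {x} → x ∈ P → ∃[ i ] x ≈ e i

  cardinality-≤ : {P : Pred Carrier p} → HasCardinality S P k →
                  (e : Fin N → Carrier) → Covers e P → k ≤ N
  cardinality-≤ {P = P} P↔k e covers = Fin.injective⇒≤ {f = index} λ {i} {j} eq →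
    injective (≈-trans (proj₂ (covers (proj₂ (to i))))
              (≈-trans (reflexive (cong e eq))
                       (≈-sym (proj₂ (covers (proj₂ (to j)))))))
    where
    open Bijection P↔k using (to; injective)
    index : Fin _ → Fin _
    index i = proj₁ (covers (proj₂ (to i)))

  cardinality-mono : {P : Pred Carrier a} {Q : Pred Carrier b} → P ⊆ Q →
                     HasCardinality S P k → HasCardinality S Q l → k ≤ l
  cardinality-mono P⊆Q P↔k Q↔l = cardinality-≤ P↔k (proj₁ ∘ to) λ x∈P →
    let i , eq = surjective (_ , P⊆Q x∈P) in i , ≈-sym (eq refl)
    where open Bijection Q↔l

  cardinality-unique : {P : Pred Carrier p} →
                       HasCardinality S P k → HasCardinality S P l → k ≡ l
  cardinality-unique P↔k P↔l =
    ≤-antisym (cardinality-mono id P↔k P↔l) (cardinality-mono id P↔l P↔k)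

  cardinality-resp-≐ : {P : Pred Carrier a} {Q : Pred Carrier b} → P ≐ Q →
                       HasCardinality S P k → HasCardinality S Q k
  cardinality-resp-≐ (P⊆Q , Q⊆P) P↔k = record
    { to        = map₂ P⊆Q ∘ to
    ; cong      = Bijection.cong P↔k
    ; bijective = injective , λ (x , x∈Q) → surjective (x , Q⊆P x∈Q)
    }
    where open Bijection P↔k using (to; injective; surjective)

  fresh⇒≉lookup : ∀ {x xs} → All (λ y → ¬ x ≈ y) xs → ∀ j → ¬ x ≈ lookup xs j
  fresh⇒≉lookup x∉xs j = All.lookupWith (λ x≉y z≈y x≈z → x≉y (≈-trans x≈z z≈y))
                                        x∉xs (∈-lookup S _ j)

  lookup-injective : ∀ {xs} → Unique S xs → Injective _≡_ _≈_ (lookup xs)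
  lookup-injective (x∉xs ∷ xs!) {zero}  {zero}  eq = refl
  lookup-injective (x∉xs ∷ xs!) {zero}  {suc j} eq =
    contradiction eq (fresh⇒≉lookup x∉xs j)
  lookup-injective (x∉xs ∷ xs!) {suc i} {zero}  eq =
    contradiction (≈-sym eq) (fresh⇒≉lookup x∉xs i)
  lookup-injective (x∉xs ∷ xs!) {suc i} {suc j} eq = cong suc (lookup-injective xs! eq)

module _ (DS : DecSetoid c ℓ) where

  open DecSetoid DS using (Carrier; _≈_; _≟_; setoid)
    renaming (refl to ≈-refl; sym to ≈-sym; trans to ≈-trans)

  -- The covering enumeration is filtered by `P` and stripped of repetitions up to `_≈_`; the
  -- positions in the remaining list count `P`.
  cardinality : {P : Pred Carrier p} → P Respects _≈_ → Decidable P →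
                (e : Fin N → Carrier) → Covers setoid e P →
                ∃[ k ] HasCardinality setoid P k
  cardinality {P = P} resp P? e covers = length xs , record
    { to        = λ i → lookup xs i , sound i
    ; cong      = λ { refl → ≈-refl }
    ; bijective = lookup-injective setoid (deduplicate-! DS ys)
                , λ (x , x∈P) → let x∈xs = complete x∈P in
                    Any.index x∈xs , λ { refl → ≈-sym (lookup-index x∈xs) }
    }
    where
    open import Data.List.Membership.Setoid setoid using () renaming (_∈_ to _∈ˡ_)

    ys xs : List Carrier
    ys = filter P? (tabulate e)
    xs = deduplicate _≟_ ys

    sound : ∀ i → lookup xs i ∈ P
    sound i = proj₂ (∈-filter⁻ setoid P? resp {xs = tabulate e}
      (∈-deduplicate⁻ setoid _≟_ ys (∈-lookup setoid xs i)))

    complete : ∀ {x} → x ∈ P → x ∈ˡ xs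
    complete x∈P with i , x≈ei ← covers x∈P =
      ∈-deduplicate⁺ setoid _≟_ (λ y≈z x≈y → ≈-trans x≈y (≈-sym y≈z))
        (∈-filter⁺ setoid P? resp
          (Any.map (≈-trans x≈ei) (∈-tabulate⁺ setoid i)) x∈P)

-- Signed sumsets

v[i]≤∑v : ∀ (v : Vector ℕ r) i → v i ≤ ∑ v
v[i]≤∑v v zero    = m≤m+n _ _
v[i]≤∑v v (suc i) = ≤-trans (v[i]≤∑v (tail v) i) (m≤n+m _ _)

-- A list of the integers from -h to h; 0 occurs twice, which a covering permits.
±toℕ : ∀ h → Fin (suc h + suc h) → ℤ
±toℕ h = [ +_ ∘ toℕ , -_ ∘ +_ ∘ toℕ ]′ ∘ splitAt (suc h)

±toℕ-covers : ∀ {h} z → ∣ z ∣ ≤ h → ∃[ j ] z ≡ ±toℕ h j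
±toℕ-covers {h} (+ n) n≤h =
  join (suc h) _ (inj₁ j) ,
  trans (cong +_ (sym (Fin.toℕ-fromℕ< (s≤s n≤h))))
        (cong [ _ , _ ]′ (sym (Fin.splitAt-join (suc h) _ (inj₁ j))))
  where j = fromℕ< (s≤s n≤h)
±toℕ-covers {h} (-[1+ n ]) n<h =
  join (suc h) _ (inj₂ j) ,
  trans (cong (-_ ∘ +_) (sym (Fin.toℕ-fromℕ< (s≤s n<h))))
        (cong [ +_ ∘ toℕ , -_ ∘ +_ ∘ toℕ ]′ (sym (Fin.splitAt-join (suc h) (suc h) (inj₂ j))))
  where j = fromℕ< (s≤s n<h)

module _ (G : AbelianGroup c ℓ) where

  open AbelianGroup G
    renaming (refl to ≈-refl; sym to ≈-sym; trans to ≈-trans; reflexive to ≈-reflexive)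
  open RawMonoid rawMonoid using (sum) renaming (_×_ to _ℕ·_)

  private
    infixr 8 _∙ᶻ_
    _∙ᶻ_ : ℤ → Carrier → Carrier
    _∙ᶻ_ = _·_ G

  ·-cong : ∀ z {x y} → x ≈ y → z ∙ᶻ x ≈ z ∙ᶻ y
  ·-cong (+ n)      x≈y = Mult.×-congʳ monoid n x≈y
  ·-cong (-[1+ n ]) x≈y = ⁻¹-cong (Mult.×-congʳ monoid (suc n) x≈y)

  signedSumset-resp-≈ : ∀ h (as : Vector Carrier m) → SignedSumset G h as Respects _≈_
  signedSumset-resp-≈ h as x≈y (λs , ∣λs∣≡h , eq) = λs , ∣λs∣≡h , ≈-trans eq x≈y

  signedSumset-mono : ∀ h {as bs : Vector Carrier m} → (∀ i → as i ≈ bs i) →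
                      SignedSumset G h as ⊆ SignedSumset G h bs
  signedSumset-mono h as≈bs (λs , ∣λs∣≡h , eq) =
    λs , ∣λs∣≡h ,
    ≈-trans (Sum.sum-cong-≋ monoid (λ i → ·-cong (λs i) (≈-sym (as≈bs i)))) eq

  -- No ∣λᵢ∣ exceeds the total h, so all coefficients lie between -h and h and a finite search
  -- suffices.
  signedSumset? : Decidable₂ _≈_ → ∀ h (as : Vector Carrier m) →
                  Decidable (SignedSumset G h as)
  signedSumset? _≈?_ h as x = anyVector? _≡_ (±toℕ h)
    (λ {λs} {μs} λs≗μs (∣λs∣≡h , eq) →
      trans (Sum.sum-cong-≗ +-0-monoid (λ i → cong ∣_∣ (sym (λs≗μs i)))) ∣λs∣≡h ,
      ≈-trans (Sum.sum-cong-≋ monoid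
                (λ i → ≈-reflexive (cong (_∙ᶻ as i) (sym (λs≗μs i))))) eq)
    (λ {λs} (∣λs∣≡h , _) i → ±toℕ-covers (λs i)
      (subst (∣ λs i ∣ ≤_) ∣λs∣≡h (v[i]≤∑v (∣_∣ ∘ λs) i)))
    (λ λs → (∑ (∣_∣ ∘ λs) ≟ℕ h) ×-dec (sum (λ i → λs i ∙ᶻ as i) ≈? x))

  -- Models the iterated sumsets k ↦ kS of a symmetric set S. Closure under inverses lets a
  -- coefficient -n cost as much as n, so that a signed combination of total weight h of elements of
  -- `S 1` lies in `S h`.
  record IsSymmetricFiltration (S : ℕ → Pred Carrier p) : Set (c Level.⊔ ℓ Level.⊔ p) where
    field
      resp    : S k Respects _≈_
      ε-mem   : ε ∈ S 0
      ∙-mem   : ∀ {x y} → x ∈ S k → y ∈ S l → x ∙ y ∈ S (k + l)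
      ⁻¹-mem  : ∀ {x} → x ∈ S k → x ⁻¹ ∈ S k

    ×-mem : ∀ n {x} → x ∈ S 1 → n ℕ· x ∈ S n
    ×-mem zero    x∈ = ε-mem
    ×-mem (suc n) x∈ = ∙-mem x∈ (×-mem n x∈)

    ·-mem : ∀ z {x} → x ∈ S 1 → z ∙ᶻ x ∈ S ∣ z ∣
    ·-mem (+ n)      x∈ = ×-mem n x∈
    ·-mem (-[1+ n ]) x∈ = ⁻¹-mem (×-mem (suc n) x∈)

    sum-mem : ∀ (λs : Vector ℤ m) {as : Vector Carrier m} → (∀ i → as i ∈ S 1) →
              sum (λ i → λs i ∙ᶻ as i) ∈ S (∑ (∣_∣ ∘ λs))
    sum-mem {zero}  λs as∈ = ε-mem
    sum-mem {suc m} λs as∈ =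
      ∙-mem (·-mem (λs zero) (as∈ zero)) (sum-mem (tail λs) (as∈ ∘ suc))

    signedSumset⊆ : ∀ {h} {as : Vector Carrier m} → (∀ i → as i ∈ S 1) →
                    SignedSumset G h as ⊆ S h
    signedSumset⊆ as∈ (λs , refl , eq) = resp eq (sum-mem λs as∈)

  signedSumset-cardinality : Decidable₂ _≈_ → {e : Fin N → Carrier} → (∀ x → ∃[ i ] x ≈ e i) →
    ∀ h (as : Vector Carrier m) → ∃[ k ] HasCardinality setoid (SignedSumset G h as) k
  signedSumset-cardinality _≈?_ {e} covers h as =
    cardinality (record { isDecEquivalence = record
                          { isEquivalence = isEquivalence ; _≟_ = _≈?_ } })
                (signedSumset-resp-≈ h as) (signedSumset? _≈?_ h as) e (λ {x} _ → covers x)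

  -- Replacing each aᵢ by its representative in the enumeration changes neither injectivity nor the
  -- sumset. For one such tuple the size can be computed, and its uniqueness settles whether it is
  -- k.
  signedSumsetSize? : Decidable₂ _≈_ → {e : Fin N → Carrier} → (∀ x → ∃[ i ] x ≈ e i) →
                      ∀ m h → Decidable (SignedSumsetSize G m h)
  signedSumsetSize? _≈?_ {e} covers m h k = anyVector? _≈_ e
    (λ {as} {bs} as≈bs (inj , card) →
      (λ eq → inj (≈-trans (as≈bs _) (≈-trans eq (≈-sym (as≈bs _))))) ,
      cardinality-resp-≐ setoid
        (signedSumset-mono h as≈bs , signedSumset-mono h (≈-sym ∘ as≈bs)) card)
    (λ {as} _ i → covers (as i))
    (λ as → injective? as ×-dec hasCardinality? as)
    where
    injective? : ∀ as → Dec (Injective _≡_ _≈_ as)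
    injective? as = map′ (λ inj {i} {j} → inj i j) (λ inj i j → inj {i} {j})
      (Fin.all? λ i → Fin.all? λ j → (as i ≈? as j) →-dec (i Fin.≟ j))

    hasCardinality? : ∀ (as : Vector Carrier m) →
                      Dec (HasCardinality setoid (SignedSumset G h as) k)
    hasCardinality? as with l , card ← signedSumset-cardinality _≈?_ covers h as =
      map′ (λ { refl → card }) (λ card′ → cardinality-unique setoid card card′) (l ≟ℕ k)

-- Mixed radix expansions

tuple : (Ns : Vector ℕ r) → Fin (∏ Ns) → ∀ i → Fin (Ns i)
tuple Ns u zero    = proj₁ (remQuot (∏ (tail Ns)) u)
tuple Ns u (suc i) = tuple (tail Ns) (proj₂ (remQuot {Ns zero} _ u)) i

untuple : (Ns : Vector ℕ r) → (∀ i → Fin (Ns i)) → Fin (∏ Ns)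
untuple {zero}  Ns us = zero
untuple {suc r} Ns us = combine (us zero) (untuple (tail Ns) (us ∘ suc))

tuple-untuple : (Ns : Vector ℕ r) (us : ∀ i → Fin (Ns i)) →
                ∀ i → tuple Ns (untuple Ns us) i ≡ us i
tuple-untuple Ns us zero =
  cong proj₁ (Fin.remQuot-combine (us zero) (untuple (tail Ns) (us ∘ suc)))
tuple-untuple Ns us (suc i) = trans
  (cong (λ uv → tuple (tail Ns) (proj₂ uv) i)
        (Fin.remQuot-combine (us zero) (untuple (tail Ns) (us ∘ suc))))
  (tuple-untuple (tail Ns) (us ∘ suc) i)

tuple-injective : (Ns : Vector ℕ r) → ∀ {u v} →
                  (∀ i → tuple Ns u i ≡ tuple Ns v i) → u ≡ v
tuple-injective {zero}  Ns {zero} {zero} eq = refl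
tuple-injective {suc r} Ns {u}    {v}    eq = begin
  u
    ≡⟨ Fin.combine-remQuot {Ns zero} _ u ⟨
  uncurry combine (remQuot {Ns zero} _ u)
    ≡⟨ cong₂ combine (eq zero) (tuple-injective (tail Ns) (eq ∘ suc)) ⟩
  uncurry combine (remQuot {Ns zero} _ v)
    ≡⟨ Fin.combine-remQuot {Ns zero} _ v ⟩
  v ∎
  where open ≡-Reasoning

-- Progressions of residue classes

module ℤmod n = AbelianGroup (ℤmod n)

_≡?_[mod_] : ∀ x y n → Dec (x ≡ y [mod n ])
x ≡? y [mod n ] = map′ congruent _≡_[mod_].difference (+ n ℤ∣.∣? x ℤ.- y)

multiple⇒≡ : ∀ {x y} z → x ℤ.- y ≡ z ℤ.* + n → x ≡ y [mod n ]
multiple⇒≡ z eq = congruent (ℤ∣.divides z eq)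

mod-coarsen : ∀ {x y} → k ∣ n → x ≡ y [mod n ] → x ≡ y [mod k ]
mod-coarsen k∣n (congruent n∣x-y) = congruent (ℤ∣.∣-trans (ℤ∣.∣ᵤ⇒∣ k∣n) n∣x-y)

-- The difference is a multiple of n of absolute value below n, hence 0.
mod-injective : k < n → l < n → + k ≡ + l [mod n ] → k ≡ l
mod-injective {k} {n} {l} k<n l<n (congruent n∣k-l) =
  ℤ.+-injective (ℤ.i-j≡0⇒i≡j (+ k) (+ l) (ℤ.∣i∣≡0⇒i≡0 (small _ ∣k-l∣<n (ℤ∣.∣⇒∣ᵤ n∣k-l))))
  where
  ∣k-l∣<n : ∣ + k ℤ.- + l ∣ < n
  ∣k-l∣<n = ≤-<-trans
    (subst (λ z → ∣ z ∣ ≤ k ⊔ l) (sym (ℤ.m-n≡m⊖n k l)) (ℤ.∣m⊝n∣≤m⊔n k l))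
    (⊔-lub k<n l<n)

  small : ∀ d → d < n → n ∣ d → d ≡ 0
  small zero    _   _   = refl
  small (suc d) d<n n∣d = contradiction n∣d (>⇒∤ d<n)

-- The union of the residue classes of tc, tc + 1, …, tc + te modulo q.

record Progression (q : ℕ) (c : ℤ) (e t : ℕ) (x : ℤ) : Set where
  constructor term
  field
    index   : ℕ
    index≤  : index ≤ t * e
    ≡term   : x ≡ + t ℤ.* c ℤ.+ + index [mod q ]

module _ (q : ℕ) (c : ℤ) (e : ℕ) where

  open ℤmod q using () renaming (trans to ≈-trans; sym to ≈-sym; reflexive to ≈-reflexive)

  progression-resp : ∀ {t} → Progression q c e t Respects ℤmod._≈_ q
  progression-resp x≈y (term j j≤te x≈) = term j j≤te (≈-trans (≈-sym x≈y) x≈)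

  progression-0 : Progression q c e 0 0ℤ
  progression-0 = term 0 z≤n (≈-reflexive (eq c))
    where
    eq : ∀ c → 0ℤ ≡ + 0 ℤ.* c ℤ.+ + 0
    eq = ℤ.solve-∀

  progression-+ : ∀ {t u x y} → Progression q c e t x → Progression q c e u y →
                  Progression q c e (t + u) (x ℤ.+ y)
  progression-+ {t} {u} {x} {y} (term j j≤te x≈) (term k k≤ue y≈) =
    term (j + k)
         (subst (j + k ≤_) (sym (*-distribʳ-+ e t u)) (+-mono-≤ j≤te k≤ue))
         (≈-trans (ℤmod.∙-cong q x≈ y≈) (≈-reflexive (eq (+ t) (+ u) c (+ j) (+ k))))
    where
    eq : ∀ t u c j k → (t ℤ.* c ℤ.+ j) ℤ.+ (u ℤ.* c ℤ.+ k) ≡ (t ℤ.+ u) ℤ.* c ℤ.+ (j ℤ.+ k)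
    eq = ℤ.solve-∀

  -- Multiplying the hypothesis by t gives 2tc + te ≡ 0, so -(tc + j) ≡ tc + (te - j): negation
  -- reverses the progression.
  progression-neg : + q ℤ∣.∣ + 2 ℤ.* c ℤ.+ + e →
                    ∀ {t x} → Progression q c e t x → Progression q c e t (- x)
  progression-neg (ℤ∣.divides z 2c+e≡zq) {t} {x} (term j j≤te x≈)
    with k , j+k≡te ← m≤n⇒∃[o]m+o≡n j≤te =
    term k (subst (k ≤_) j+k≡te (m≤n+m k j))
      (≈-trans (ℤmod.⁻¹-cong q x≈) (multiple⇒≡ (- (+ t ℤ.* z)) (begin
        - (s ℤ.+ + j) ℤ.- (s ℤ.+ + k)
          ≡⟨ eq₁ s (+ j) (+ k) ⟩
        - (+ 2 ℤ.* s ℤ.+ + (j + k))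
          ≡⟨ cong (λ i → - (+ 2 ℤ.* s ℤ.+ i)) (trans (cong +_ j+k≡te) (ℤ.pos-* t e)) ⟩
        - (+ 2 ℤ.* s ℤ.+ + t ℤ.* + e)
          ≡⟨ eq₂ (+ t) c (+ e) ⟩
        - (+ t ℤ.* (+ 2 ℤ.* c ℤ.+ + e))
          ≡⟨ cong (λ i → - (+ t ℤ.* i)) 2c+e≡zq ⟩
        - (+ t ℤ.* (z ℤ.* + q))
          ≡⟨ eq₃ (+ t) z (+ q) ⟩
        - (+ t ℤ.* z) ℤ.* + q
          ∎)))
    where
    open ≡-Reasoning
    s : ℤ
    s = + t ℤ.* c
    eq₁ : ∀ s j k → - (s ℤ.+ j) ℤ.- (s ℤ.+ k) ≡ - (+ 2 ℤ.* s ℤ.+ (j ℤ.+ k))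
    eq₁ = ℤ.solve-∀
    eq₂ : ∀ t c e → - (+ 2 ℤ.* (t ℤ.* c) ℤ.+ t ℤ.* e) ≡ - (t ℤ.* (+ 2 ℤ.* c ℤ.+ e))
    eq₂ = ℤ.solve-∀
    eq₃ : ∀ t z q → - (t ℤ.* (z ℤ.* q)) ≡ - (t ℤ.* z) ℤ.* q
    eq₃ = ℤ.solve-∀

  module _ (d t : ℕ) where

    -- One residue class modulo q splits into d classes modulo qd. Here j picks the term of the
    -- progression and l the lift.
    offset : Fin (suc (t * e)) × Fin d → ℕ
    offset (j , l) = q * toℕ l + toℕ j

    point : Fin (suc (t * e) * d) → ℤ
    point u = + t ℤ.* c ℤ.+ + offset (remQuot d u)

    point∈progression : ∀ u → Progression q c e t (point u)
    point∈progression u = offset-mem (remQuot d u)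
      where
      eq : ∀ s q l j → (s ℤ.+ (q ℤ.* l ℤ.+ j)) ℤ.- (s ℤ.+ j) ≡ l ℤ.* q
      eq = ℤ.solve-∀

      offset-mem : ∀ jl → Progression q c e t (+ t ℤ.* c ℤ.+ + offset jl)
      offset-mem (j , l) = term (toℕ j) (Fin.toℕ≤pred[n] j) (multiple⇒≡ (+ toℕ l) (trans
        (cong (λ i → (+ t ℤ.* c ℤ.+ (i ℤ.+ + toℕ j)) ℤ.- (+ t ℤ.* c ℤ.+ + toℕ j))
              (ℤ.pos-* q (toℕ l)))
        (eq (+ t ℤ.* c) (+ q) (+ toℕ l) (+ toℕ j))))

    -- Write x = tc + j + zq. Modulo qd only z mod d matters, and this remainder is the lift l; the
    -- quotient of z by d is the discarded multiple of qd.
    point-covers : .{{NonZero d}} → ∀ {x} → Progression q c e t x →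
                   ∃[ u ] x ≡ point u [mod q * d ]
    point-covers {x} (term j j≤te (congruent (ℤ∣.divides z x-y≡zq))) =
      combine j′ l′ ,
      multiple⇒≡ w (begin
        x ℤ.- (s ℤ.+ + offset (remQuot d (combine j′ l′)))
          ≡⟨ cong (λ i → x ℤ.- (s ℤ.+ + offset i)) (Fin.remQuot-combine j′ l′) ⟩
        x ℤ.- (s ℤ.+ + (q * toℕ l′ + toℕ j′))
          ≡⟨ cong₂ (λ i j → x ℤ.- (s ℤ.+ + (q * i + j)))
                   (Fin.toℕ-fromℕ< z%d<d) (Fin.toℕ-fromℕ< (s≤s j≤te)) ⟩
        x ℤ.- (s ℤ.+ (+ (q * z%d) ℤ.+ + j))
          ≡⟨ cong (λ i → x ℤ.- (s ℤ.+ (i ℤ.+ + j))) (ℤ.pos-* q z%d) ⟩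
        x ℤ.- (s ℤ.+ (+ q ℤ.* + z%d ℤ.+ + j))
          ≡⟨ eq₁ x s (+ q) (+ z%d) (+ j) ⟩
        (x ℤ.- (s ℤ.+ + j)) ℤ.- + z%d ℤ.* + q
          ≡⟨ cong (ℤ._- + z%d ℤ.* + q) x-y≡zq ⟩
        z ℤ.* + q ℤ.- + z%d ℤ.* + q
          ≡⟨ cong (λ i → i ℤ.* + q ℤ.- + z%d ℤ.* + q) (ℤ.a≡a%ℕn+[a/ℕn]*n z d) ⟩
        (+ z%d ℤ.+ w ℤ.* + d) ℤ.* + q ℤ.- + z%d ℤ.* + q
          ≡⟨ eq₂ (+ z%d) w (+ d) (+ q) ⟩
        w ℤ.* (+ q ℤ.* + d)
          ≡⟨ cong (w ℤ.*_) (ℤ.pos-* q d) ⟨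
        w ℤ.* + (q * d)
          ∎)
      where
      open ≡-Reasoning
      s w : ℤ
      s = + t ℤ.* c
      w = z ℤ./ℕ d
      z%d : ℕ
      z%d = z ℤ.%ℕ d
      z%d<d : z%d < d
      z%d<d = ℤ.n%ℕd<d z d
      j′ : Fin (suc (t * e))
      j′ = fromℕ< (s≤s j≤te)
      l′ : Fin d
      l′ = fromℕ< z%d<d
      eq₁ : ∀ x s q l j → x ℤ.- (s ℤ.+ (q ℤ.* l ℤ.+ j)) ≡ (x ℤ.- (s ℤ.+ j)) ℤ.- l ℤ.* q
      eq₁ = ℤ.solve-∀
      eq₂ : ∀ l w d q → (l ℤ.+ w ℤ.* d) ℤ.* q ℤ.- l ℤ.* q ≡ w ℤ.* (q ℤ.* d)
      eq₂ = ℤ.solve-∀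

    -- As j ≤ te < q, the offset ql + j is an expansion in base q: it lies below qd and determines
    -- both digits.
    point-injective : t * e < q → ∀ {u v} → point u ≡ point v [mod q * d ] → u ≡ v
    point-injective te<q {u} {v} (congruent qd∣) = begin
      u
        ≡⟨ Fin.combine-remQuot {suc (t * e)} d u ⟨
      uncurry combine (remQuot d u)
        ≡⟨ cong (uncurry combine)
                (pair-injective (remQuot d u) (remQuot d v) offset-≡) ⟩
      uncurry combine (remQuot d v)
        ≡⟨ Fin.combine-remQuot {suc (t * e)} d v ⟩
      v ∎
      where
      open ≡-Reasoning

      -- Widening the range of j from te + 1 values to q turns the offset into a value of `combine`,
      -- which supplies the bound qd and injectivity.
      digits : Fin (suc (t * e)) × Fin d → Fin (d * q)
      digits (j , l) = combine l (inject≤ j te<q)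

      toℕ-digits : ∀ jl → toℕ (digits jl) ≡ offset jl
      toℕ-digits (j , l) = trans (Fin.toℕ-combine l _)
        (cong (λ i → q * toℕ l + i) (Fin.toℕ-inject≤ j te<q))

      offset<qd : ∀ jl → offset jl < q * d
      offset<qd jl = subst₂ _<_ (toℕ-digits jl) (*-comm d q) (Fin.toℕ<n (digits jl))

      offset-≡ : offset (remQuot d u) ≡ offset (remQuot d v)
      offset-≡ = mod-injective (offset<qd (remQuot d u)) (offset<qd (remQuot d v))
        (congruent (subst (+ (q * d) ℤ∣.∣_)
          (eq (+ t ℤ.* c) (+ offset (remQuot d u)) (+ offset (remQuot d v))) qd∣))
        where
        eq : ∀ s i j → (s ℤ.+ i) ℤ.- (s ℤ.+ j) ≡ i ℤ.- j
        eq = ℤ.solve-∀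

      pair-injective : ∀ jl jl′ → offset jl ≡ offset jl′ → jl ≡ jl′
      pair-injective (j , l) (j′ , l′) eq
        with refl , j≡j′ ← Fin.combine-injective l _ l′ _
               (Fin.toℕ-injective
                 (trans (toℕ-digits (j , l)) (trans eq (sym (toℕ-digits (j′ , l′))))))
        = cong (_, l) (Fin.inject≤-injective te<q te<q j j′ j≡j′)

-- Boxes of progressions in G

updateAt-elim : (P : Fin r → A → Set p) (xs : Vector A r) (i : Fin r) {f : A → A} →
                P i (f (xs i)) → (∀ j → j ≢ i → P j (xs j)) →
                ∀ j → P j (updateAt xs i f j)
updateAt-elim P xs i {f} Pi Pj j with j Fin.≟ i
... | yes refl = subst (P j) (sym (updateAt-updates i xs)) Pi
... | no  j≢i  = subst (P j) (sym (updateAt-minimal j i xs j≢i)) (Pj j j≢i)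

∏-cong : {v w : Vector ℕ r} → (∀ i → v i ≡ w i) → ∏ v ≡ ∏ w
∏-cong = Sum.sum-cong-≗ *-1-monoid

∏-scale : (v w : Vector ℕ r) (i : Fin r) → v i ≡ k * w i →
          (∀ j → j ≢ i → v j ≡ w j) → ∏ v ≡ k * ∏ w
∏-scale {k = k} v w zero vi≡ vj≡ = trans
  (cong₂ _*_ vi≡ (∏-cong λ j → vj≡ (suc j) λ ())) (*-assoc k (w zero) _)
∏-scale {k = k} v w (suc i) vi≡ vj≡ = trans
  (cong₂ _*_ (vj≡ zero λ ())
             (∏-scale {k = k} (tail v) (tail w) i vi≡ λ j j≢i →
               vj≡ (suc j) (j≢i ∘ Fin.suc-injective)))
  (eq (w zero) k (∏ (tail w)))
  where
  eq : ∀ x y z → x * (y * z) ≡ y * (x * z)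
  eq = ℕ.solve-∀

-- Symmetric progressions modulo q

parity : ∀ n → (∃[ b ] n ≡ 2 * b) ⊎ (∃[ b ] n ≡ suc (2 * b))
parity zero = inj₁ (0 , refl)
parity (suc n) with parity n
... | inj₁ (b , refl) = inj₂ (b , refl)
... | inj₂ (b , refl) = inj₁ (suc b , cong suc (sym (+-suc b (b + 0))))

-- With e = k - 1, this is the search for the start c of the overview. For e = 2b take c = -b. For e
-- = 2b + 1 and q = 2q′ + 1 take c = q′ - b, which makes 2c + e equal to q. When e is odd and q
-- even, 2c + e is odd and no start exists.
symmetricStart : ∀ e q → (∃[ c ] + q ℤ∣.∣ + 2 ℤ.* c ℤ.+ + e) ⊎
                         (∃₂ λ b q′ → e ≡ suc (2 * b) × q ≡ 2 * q′)
symmetricStart e q with parity e | parity q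
... | inj₁ (b , refl) | _ = inj₁ (- + b , ℤ∣.divides 0ℤ
  (trans (cong (λ i → + 2 ℤ.* - + b ℤ.+ i) (ℤ.pos-* 2 b)) (eq (+ b) (+ q))))
  where
  eq : ∀ b q → + 2 ℤ.* - b ℤ.+ + 2 ℤ.* b ≡ 0ℤ ℤ.* q
  eq = ℤ.solve-∀
... | inj₂ (b , refl) | inj₂ (q′ , refl) = inj₁ (+ q′ ℤ.- + b , ℤ∣.divides (+ 1) (begin
    + 2 ℤ.* (+ q′ ℤ.- + b) ℤ.+ (+ 1 ℤ.+ + (2 * b))
      ≡⟨ cong (λ i → + 2 ℤ.* (+ q′ ℤ.- + b) ℤ.+ (+ 1 ℤ.+ i)) (ℤ.pos-* 2 b) ⟩
    + 2 ℤ.* (+ q′ ℤ.- + b) ℤ.+ (+ 1 ℤ.+ + 2 ℤ.* + b)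
      ≡⟨ eq (+ q′) (+ b) ⟩
    + 1 ℤ.* (+ 1 ℤ.+ + 2 ℤ.* + q′)
      ≡⟨ cong (λ i → + 1 ℤ.* (+ 1 ℤ.+ i)) (ℤ.pos-* 2 q′) ⟨
    + 1 ℤ.* (+ 1 ℤ.+ + (2 * q′)) ∎))
  where
  open ≡-Reasoning
  eq : ∀ q b → + 2 ℤ.* (q ℤ.- b) ℤ.+ (+ 1 ℤ.+ + 2 ℤ.* b) ≡ + 1 ℤ.* (+ 1 ℤ.+ + 2 ℤ.* q)
  eq = ℤ.solve-∀
... | inj₂ (b , e≡) | inj₁ (q′ , q≡) = inj₂ (b , q′ , e≡ , q≡)

-- Boxes in a group of given type and their sumsets

module _ {G : AbelianGroup c ℓ} {s} {ns : Vector ℕ (suc s)} (G-type : HasType G ns) where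

  open AbelianGroup G
    renaming (refl to ≈-refl; sym to ≈-sym; trans to ≈-trans; reflexive to ≈-reflexive)
  open HasType G-type
  open GroupMorphisms rawGroup (AbelianGroup.rawGroup (∏ᴳ (ℤmod ∘ ns)))

  private
    φ : Carrier → ∀ i → ℤ
    φ = proj₁ isomorphism

    module φ = IsGroupIsomorphism (proj₂ isomorphism)

    φ⁻¹ : (∀ i → ℤ) → Carrier
    φ⁻¹ y = proj₁ (φ.surjective y)

    φ-φ⁻¹ : ∀ y i → φ (φ⁻¹ y) i ≡ y i [mod ns i ]
    φ-φ⁻¹ y = proj₂ (φ.surjective y) ≈-refl

  infix 4 _≈?_
  _≈?_ : Decidable₂ _≈_
  x ≈? y = map′ φ.injective φ.⟦⟧-cong (Fin.all? λ i → φ x i ≡? φ y i [mod ns i ])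

  -- A progression is allowed in every coordinate, so that one construction yields both the set S,
  -- as `box 1` with eᵢ = 0 below the last coordinate, and an enumeration of G.
  module Box (qs ds es : Vector ℕ (suc s)) (cs : Vector ℤ (suc s))
             (ns≡qs*ds : ∀ i → ns i ≡ qs i * ds i) where

    box : ℕ → Pred Carrier _
    box t x = ∀ i → Progression (qs i) (cs i) (es i) t (φ x i)

    radices : ℕ → Vector ℕ (suc s)
    radices t i = suc (t * es i) * ds i

    -- The exact size of the box while no progression wraps around (`element-injective`), and always
    -- an upper bound (`element-covers`). The first is used for t = 1, the second for t = h.
    boxSize : ℕ → ℕ
    boxSize t = ∏ (radices t)

    private
      mod-qs : ∀ {i x y} → x ≡ y [mod ns i ] → x ≡ y [mod qs i ]
      mod-qs {i} = mod-coarsen (divides (ds i) (trans (ns≡qs*ds i) (*-comm (qs i) (ds i))))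

    filtration : (∀ i → + qs i ℤ∣.∣ + 2 ℤ.* cs i ℤ.+ + es i) → IsSymmetricFiltration G box
    filtration symmetric = record
      { resp   = λ x≈y x∈ i → respᵢ i (φ.⟦⟧-cong x≈y i) (x∈ i)
      ; ε-mem  = λ i → respᵢ i (ℤmod.sym (ns i) (φ.ε-homo i))
                   (progression-0 (qs i) (cs i) (es i))
      ; ∙-mem  = λ x∈ y∈ i → respᵢ i (ℤmod.sym (ns i) (φ.∙-homo _ _ i))
                   (progression-+ (qs i) (cs i) (es i) (x∈ i) (y∈ i))
      ; ⁻¹-mem = λ x∈ i → respᵢ i (ℤmod.sym (ns i) (φ.⁻¹-homo _ i))
                   (progression-neg (qs i) (cs i) (es i) (symmetric i) (x∈ i))
      }
      where
      respᵢ : ∀ i {t x y} → x ≡ y [mod ns i ] → Progression (qs i) (cs i) (es i) t x →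
              Progression (qs i) (cs i) (es i) t y
      respᵢ i = progression-resp (qs i) (cs i) (es i) ∘ mod-qs

    points : ∀ t → Fin (boxSize t) → ∀ i → ℤ
    points t u i = point (qs i) (cs i) (es i) (ds i) t (tuple (radices t) u i)

    element : ∀ t → Fin (boxSize t) → Carrier
    element t u = φ⁻¹ (points t u)

    element∈box : ∀ t u → element t u ∈ box t
    element∈box t u i = progression-resp (qs i) (cs i) (es i)
      (ℤmod.sym (qs i) (mod-qs (φ-φ⁻¹ (points t u) i)))
      (point∈progression (qs i) (cs i) (es i) (ds i) t (tuple (radices t) u i))

    element-covers : ∀ t → Covers setoid (element t) (box t)
    element-covers t {x} x∈ = untuple (radices t) us , φ.injective λ i → ℤmod.trans (ns i)
      (subst₂ (λ n u → φ x i ≡ point (qs i) (cs i) (es i) (ds i) t u [mod n ])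
        (sym (ns≡qs*ds i)) (sym (tuple-untuple (radices t) us i)) (proj₂ (covers i)))
      (ℤmod.sym (ns i) (φ-φ⁻¹ (points t (untuple (radices t) us)) i))
      where
      covers : ∀ i → ∃[ u ] φ x i ≡ point (qs i) (cs i) (es i) (ds i) t u [mod qs i * ds i ]
      covers i = point-covers (qs i) (cs i) (es i) (ds i) t
        {{m*n≢0⇒n≢0 (qs i) {{subst NonZero (ns≡qs*ds i) (nonZero i)}}}} (x∈ i)

      us : ∀ i → Fin (suc (t * es i) * ds i)
      us = proj₁ ∘ covers

    element-injective : ∀ t → (∀ i → t * es i < qs i) → Injective _≡_ _≈_ (element t)
    element-injective t te<q {u} {v} eq = tuple-injective (radices t) λ i →
      point-injective (qs i) (cs i) (es i) (ds i) t (te<q i)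
        (subst (λ n → points t u i ≡ points t v i [mod n ]) (ns≡qs*ds i)
          (ℤmod.trans (ns i) (ℤmod.sym (ns i) (φ-φ⁻¹ (points t u) i))
            (ℤmod.trans (ns i) (φ.⟦⟧-cong eq i) (φ-φ⁻¹ (points t v) i))))

  private
    -- With all qᵢ = 1 the box is the whole of G.

    module Whole = Box (λ _ → 1) ns (λ _ → 0) (λ _ → 0ℤ) (λ i → sym (*-identityˡ (ns i)))

  enumeration-covers : ∀ x → ∃[ u ] x ≈ Whole.element 0 u
  enumeration-covers x = Whole.element-covers 0 λ i →
    term 0 z≤n (multiple⇒≡ (φ x i) (eq (φ x i)))
    where
    eq : ∀ x → x ℤ.- (+ 0 ℤ.* 0ℤ ℤ.+ + 0) ≡ x ℤ.* + 1
    eq = ℤ.solve-∀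

  module _ {qs ds es : Vector ℕ (suc s)} {cs : Vector ℤ (suc s)}
           (ns≡qs*ds : ∀ i → ns i ≡ qs i * ds i) where

    open Box qs ds es cs ns≡qs*ds

    -- A consists of the first m elements listed for `box 1`, distinct because eᵢ < qᵢ. Symmetry
    -- puts its signed sumset inside `box h`.
    box-sumset : (∀ i → + qs i ℤ∣.∣ + 2 ℤ.* cs i ℤ.+ + es i) → (∀ i → es i < qs i) →
                 ∀ h → m ≤ boxSize 1 → ∃[ k ] SignedSumsetSize G m h k × k ≤ boxSize h
    box-sumset symmetric e<q h m≤ =
      proj₁ size ,
      (as , inj , proj₂ size) ,
      cardinality-≤ setoid (proj₂ size) (element h) λ x∈ →
        element-covers h (IsSymmetricFiltration.signedSumset⊆ (filtration symmetric)
                           (λ i → element∈box 1 (inject≤ i m≤)) x∈)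
      where
      as : Vector Carrier _
      as i = element 1 (inject≤ i m≤)

      inj : Injective _≡_ _≈_ as
      inj {i} {j} eq = Fin.inject≤-injective m≤ m≤ i j
        (element-injective 1 (λ i → subst (_< qs i) (sym (*-identityˡ (es i))) (e<q i)) eq)

      size : ∃[ k ] HasCardinality setoid (SignedSumset G h as) k
      size = signedSumset-cardinality G _≈?_ enumeration-covers h as

  private
    top : Fin (suc s)
    top = fromℕ s

    Bounded : ℕ → ℕ → ℕ → ℕ → Set _
    Bounded m h e d = ∃[ k ] SignedSumsetSize G m h k × k ≤ suc (h * e) * d

  -- Here k = e + 1. The induction is strong because the halving of k may have to be repeated, as
  -- long as k and qᵣ are both even.
  small-sumset : ∀ h → 1 ≤ h → ∀ e (qs ds : Vector ℕ (suc s)) →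
                 (∀ i → ns i ≡ qs i * ds i) → m ≤ suc e * ∏ ds → e < last qs →
                 Bounded m h e (∏ ds)
  small-sumset {m} h 1≤h = <-rec _ step
    where
    step : ∀ e → (∀ {b} → b < e → ∀ qs ds → (∀ i → ns i ≡ qs i * ds i) →
                  m ≤ suc b * ∏ ds → b < last qs → Bounded m h b (∏ ds)) →
           ∀ qs ds → (∀ i → ns i ≡ qs i * ds i) → m ≤ suc e * ∏ ds → e < last qs →
           Bounded m h e (∏ ds)
    step e rec qs ds ns≡ m≤ e<q with symmetricStart e (last qs)
    -- Only the last coordinate carries a progression; the others keep e = 0 and c = 0, that is, the
    -- multiples of qᵢ.
    ... | inj₁ (c , symmetric) = map₂ (map₂ λ k≤ → ≤-trans k≤ (≤-reflexive (boxSize≡ h)))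
      (box-sumset {es = proj₁ ∘ ecs} {cs = proj₂ ∘ ecs} ns≡
        (updateAt-elim (λ i ec → + qs i ℤ∣.∣ + 2 ℤ.* proj₂ ec ℤ.+ + proj₁ ec)
          trivial top {λ _ → e , c} symmetric λ i _ → ℤ∣.divides 0ℤ refl)
        (updateAt-elim (λ i ec → proj₁ ec < qs i) trivial top {λ _ → e , c} e<q
          λ i _ → >-nonZero⁻¹ (qs i)
            {{m*n≢0⇒m≢0 (qs i) {{subst NonZero (ns≡ i) (nonZero i)}}}})
        h (subst (m ≤_) (sym (trans (boxSize≡ 1)
            (cong (λ e → suc e * ∏ ds) (*-identityˡ e)))) m≤))
      where
      trivial ecs : Vector (ℕ × ℤ) (suc s)
      trivial _ = 0 , 0ℤ
      ecs = updateAt trivial top (λ _ → e , c)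

      boxSize≡ : ∀ t → ∏ (λ i → suc (t * proj₁ (ecs i)) * ds i) ≡ suc (t * e) * ∏ ds
      boxSize≡ t = ∏-scale {k = suc (t * e)} _ ds top
        (cong (λ ec → suc (t * proj₁ ec) * ds top)
              (updateAt-updates top {λ _ → e , c} trivial))
        (λ i i≢top → trans
          (cong (λ ec → suc (t * proj₁ ec) * ds i)
                (updateAt-minimal i top {λ _ → e , c} trivial i≢top))
          (trans (cong (λ te → suc te * ds i) (*-zeroʳ t)) (*-identityˡ (ds i))))
    -- A factor 2 moves from qᵣ to dᵣ. This preserves nᵣ and the box size, as (2b + 2)d = (b +
    -- 1)(2d), and 2b + 2 ≤ 2q′ gives b < q′.
    ... | inj₂ (b , q′ , refl , q≡2q′) = map₂ (map₂ λ k≤ → ≤-trans k≤ bound)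
      (rec (s≤s (m≤n*m b 2)) (proj₁ ∘ qds) (proj₂ ∘ qds)
        (updateAt-elim (λ i qd → ns i ≡ proj₁ qd * proj₂ qd) old top {λ _ → new}
          (trans (ns≡ top) (trans (cong (_* ds top) q≡2q′) (eq₁ q′ (ds top))))
          λ i _ → ns≡ i)
        (subst (m ≤_) (trans (eq₂ b (∏ ds)) (cong (suc b *_) (sym ∏≡))) m≤)
        (subst (b <_) (cong proj₁ (sym (updateAt-updates top {λ _ → new} old)))
          (*-cancelˡ-≤ 2 (subst₂ _≤_ (eq₃ b) q≡2q′ e<q))))
      where
      old qds : Vector (ℕ × ℕ) (suc s)
      old i = qs i , ds i
      new : ℕ × ℕ
      new = q′ , 2 * ds top
      qds = updateAt old top (λ _ → new)

      ∏≡ : ∏ (proj₂ ∘ qds) ≡ 2 * ∏ ds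
      ∏≡ = ∏-scale {k = 2} _ ds top
        (cong proj₂ (updateAt-updates top {λ _ → new} old))
        (λ i i≢top → cong proj₂ (updateAt-minimal i top {λ _ → new} old i≢top))

      eq₁ : ∀ q d → 2 * q * d ≡ q * (2 * d)
      eq₁ = ℕ.solve-∀
      eq₂ : ∀ b d → suc (suc (2 * b)) * d ≡ suc b * (2 * d)
      eq₂ = ℕ.solve-∀
      eq₃ : ∀ b → suc (suc (2 * b)) ≡ 2 * suc b
      eq₃ = ℕ.solve-∀
      eq₄ : ∀ h b d → suc (h * b) * (2 * d) ≡ suc (1 + h * (2 * b)) * d
      eq₄ = ℕ.solve-∀

      -- The two sides differ by (h - 1)d, so this is where h ≥ 1 enters.
      bound : suc (h * b) * ∏ (proj₂ ∘ qds) ≤ suc (h * suc (2 * b)) * ∏ ds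
      bound = begin
        suc (h * b) * ∏ (proj₂ ∘ qds)      ≡⟨ cong (suc (h * b) *_) ∏≡ ⟩
        suc (h * b) * (2 * ∏ ds)           ≡⟨ eq₄ h b (∏ ds) ⟩
        suc (1 + h * (2 * b)) * ∏ ds       ≤⟨ *-monoˡ-≤ (∏ ds) (s≤s (+-monoˡ-≤ _ 1≤h)) ⟩
        suc (h + h * (2 * b)) * ∏ ds       ≡⟨ cong (λ i → suc i * ∏ ds) (*-suc h (2 * b)) ⟨
        suc (h * suc (2 * b)) * ∏ ds       ∎
        where open ≤-Reasoning

-- The values f_d(m,h)

m≤⌈m/d⌉*d : ∀ m d .{{_ : NonZero d}} → m ≤ ⌈ m / d ⌉ * d
m≤⌈m/d⌉*d m d@(suc d-1) = +-cancelʳ-≤ d-1 m _ (begin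
  m + d-1                               ≡⟨ m≡m%n+[m/n]*n (m + d-1) d ⟩
  (m + d-1) % d + ⌈ m / d ⌉ * d         ≤⟨ +-monoˡ-≤ _ (≤-pred (m%n<n (m + d-1) d)) ⟩
  d-1 + ⌈ m / d ⌉ * d                   ≡⟨ +-comm d-1 _ ⟩
  ⌈ m / d ⌉ * d + d-1                   ∎)
  where open ≤-Reasoning

⌈m/d⌉≤n : ∀ m n d .{{_ : NonZero d}} → m ≤ n * d → ⌈ m / d ⌉ ≤ n
⌈m/d⌉≤n m n d@(suc d-1) m≤nd = ≤-pred (m<n*o⇒m/o<n {m + d-1} {suc n} {d} (begin-strict
  m + d-1       ≤⟨ +-monoˡ-≤ d-1 m≤nd ⟩
  n * d + d-1   <⟨ +-monoʳ-< (n * d) (n<1+n d-1) ⟩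
  n * d + d     ≡⟨ +-comm (n * d) d ⟩
  suc n * d     ∎))
  where open ≤-Reasoning

-- A tuple of divisors determines d, and every dᵢ is at most nᵢ, hence at most the sum of all nᵢ,
-- which serves as a common bound for the search.
fValue? : {ns : Vector ℕ (suc r)} → (∀ i → NonZero (ns i)) →
          ∀ m h → Decidable (fValue ns m h)
fValue? {r} {ns} ns≢0 m h v = map′
  (λ (ds , ds∈ , d∈ , bound , _ , v≡) → ∏ ds , record
    { d∈D[n] = d∈ ; ds = ds ; dᵢ∈D[nᵢ] = ds∈ ; d≡∏ds = refl ; bound = bound } , v≡)
  (λ { (_ , record { d∈D[n] = d∈ ; ds = ds ; dᵢ∈D[nᵢ] = ds∈
                   ; d≡∏ds = refl ; bound = bound } , v≡) →
       ds , ds∈ , d∈ , bound , proj₁ d∈ , v≡ })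
  (anyVector? _≡_ toℕ
    (λ ds≗es (ds∈ , cond) →
      (λ i → subst (_∈ D (ns i)) (ds≗es i) (ds∈ i)) ,
      subst₂ Condition (∏-cong ds≗es) (ds≗es (fromℕ r)) cond)
    (λ {ds} (ds∈ , _) i →
      let d≤∑ = ≤-trans (∣⇒≤ {{ns≢0 i}} (proj₂ (ds∈ i))) (v[i]≤∑v ns i)
      in fromℕ< (s≤s d≤∑) , sym (Fin.toℕ-fromℕ< (s≤s d≤∑)))
    (λ ds → Fin.all? (λ i → D? (ns i) (ds i)) ×-dec condition? (∏ ds) (last ds)))
  where
  -- Stated through the product and the last entry alone, so that it transports between tuples that
  -- agree only pointwise.
  Condition : ℕ → ℕ → Set
  Condition d dᵣ = d ∈ D (∏ ns) × dᵣ * m ≤ d * last ns ×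
                   Σ[ d≢0 ∈ NonZero d ] v ≡ f d {{d≢0}} m h

  D? : ∀ k → Decidable (D k)
  D? k d = nonZero? d ×-dec (d ∣? k)

  value? : ∀ d → Dec (Σ[ d≢0 ∈ NonZero d ] v ≡ f d {{d≢0}} m h)
  value? d with nonZero? d
  ... | yes d≢0 = map′ (d≢0 ,_) proj₂ (v ≟ℕ f d {{d≢0}} m h)
  ... | no  d≡0 = no (d≡0 ∘ proj₁)

  condition? : ∀ d dᵣ → Dec (Condition d dᵣ)
  condition? d dᵣ = D? (∏ ns) d ×-dec (dᵣ * m ≤? d * last ns) ×-dec value? d

∏-nonZero : {v : Vector ℕ r} → (∀ i → NonZero (v i)) → NonZero (∏ v)
∏-nonZero {zero}  v≢0 = _
∏-nonZero {suc r} v≢0 = m*n≢0 _ _ {{v≢0 zero}} {{∏-nonZero (v≢0 ∘ suc)}}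

-- The choice d = n is admissible: its bound is m ≤ n multiplied by nᵣ.
fValue-nonempty : {ns : Vector ℕ (suc r)} → (∀ i → NonZero (ns i)) →
                  ∀ m h → m ≤ ∏ ns → ∃ (fValue ns m h)
fValue-nonempty {r} {ns} ns≢0 m h m≤n = _ , ∏ ns , record
  { d∈D[n]   = ∏-nonZero ns≢0 , ∣-refl
  ; ds       = ns
  ; dᵢ∈D[nᵢ] = λ i → ns≢0 i , ∣-refl
  ; d≡∏ds    = refl
  ; bound    = subst (last ns * m ≤_) (*-comm (last ns) (∏ ns)) (*-monoʳ-≤ (last ns) m≤n)
  } , refl

module _ {G : AbelianGroup c ℓ} {s} {ns : Vector ℕ (suc s)} (G-type : HasType G ns) where

  fValue-sumset : ∀ {m h v} → 1 ≤ m → 1 ≤ h → v ∈ fValue ns m h →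
                  ∃[ k ] SignedSumsetSize G m h k × k ≤ v
  fValue-sumset {m} {h} 1≤m 1≤h
    (_ , record { d∈D[n] = d≢0 , _ ; ds = ds ; dᵢ∈D[nᵢ] = ds∈
                ; d≡∏ds = refl ; bound = bound } , refl)
    = go ⌈ m / ∏ ds ⌉ (m≤⌈m/d⌉*d m (∏ ds)) (⌈m/d⌉≤n m (last qs) (∏ ds) m≤qd)
    where
    instance _ = d≢0

    qs : Vector ℕ (suc s)
    qs i = quotient (proj₂ (ds∈ i))

    ns≡ : ∀ i → ns i ≡ qs i * ds i
    ns≡ i = _∣_.equality (proj₂ (ds∈ i))

    -- Cancelling dᵣ from dᵣm ≤ dnᵣ = dqᵣdᵣ leaves m ≤ qᵣd, which is what makes ⌈m/d⌉ ≤ qᵣ.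
    m≤qd : m ≤ last qs * ∏ ds
    m≤qd = *-cancelˡ-≤ (last ds) {{proj₁ (ds∈ (fromℕ s))}} (begin
      last ds * m                    ≤⟨ bound ⟩
      ∏ ds * last ns                 ≡⟨ cong (∏ ds *_) (ns≡ (fromℕ s)) ⟩
      ∏ ds * (last qs * last ds)     ≡⟨ eq (∏ ds) (last qs) (last ds) ⟩
      last ds * (last qs * ∏ ds)     ∎)
      where
      open ≤-Reasoning
      eq : ∀ x y z → x * (y * z) ≡ z * (y * x)
      eq = ℕ.solve-∀

    -- The ceiling is generalised to k in order to match it as e + 1; k = 0 would force m = 0. Then
    -- hk - h is he, so the truncated subtraction is exact.
    go : ∀ k → m ≤ k * ∏ ds → k ≤ last qs →
         ∃[ l ] SignedSumsetSize G m h l × l ≤ (h * k ∸ h + 1) * ∏ ds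
    go zero    m≤0 _   = contradiction (≤-trans 1≤m m≤0) λ ()
    go (suc e) m≤  e<q = map₂ (map₂ λ l≤ → ≤-trans l≤ (≤-reflexive (cong (_* ∏ ds) (begin
      suc (h * e)              ≡⟨ +-comm 1 (h * e) ⟩
      h * e + 1                ≡⟨ cong (_+ 1) (m+n∸m≡n h (h * e)) ⟨
      h + h * e ∸ h + 1        ≡⟨ cong (λ i → i ∸ h + 1) (*-suc h e) ⟨
      h * suc e ∸ h + 1        ∎))))
      (small-sumset G-type h 1≤h e qs ds ns≡ m≤ e<q)
      where open ≡-Reasoning

theorem5 : ∀ {c ℓ} (G : AbelianGroup c ℓ) {s} (ns : Vector ℕ (suc s)) →
    HasType G ns →
    ∀ m h → 1 ≤ m → m ≤ ∏ ns → 2 ≤ h →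
    ∃[ ρ ] ∃[ μ ]
    Isρ± G m h ρ × μ IsMinimumOf fValue ns m h × ρ ≤ μ
theorem5 G ns G-type m h 1≤m m≤n 2≤h =
  let ns≢0                = HasType.nonZero G-type
      μ , μ-value , μ-min = least (fValue? ns≢0 m h) (proj₂ (fValue-nonempty ns≢0 m h m≤n))
      -- The set built for a minimising d does double duty: its size k bounds ρ, and it starts the
      -- search that finds ρ.
      k , k-size , k≤μ    = fValue-sumset G-type 1≤m (<⇒≤ 2≤h) μ-value
      ρ , ρ-size , ρ-min  = least
        (signedSumsetSize? G (_≈?_ G-type) (enumeration-covers G-type) m h) k-size
  in ρ , μ , (ρ-size , ρ-min) , (μ-value , μ-min) , ≤-trans (ρ-min k-size) k≤μ
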